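{- There is an absolute constant $b > 0$ such that the following holds. Let $G$ be a finite abelian group with $|G|\ge 2$, and let $C \subseteq G$ be a non-empty solid subset. If $$|C| \leq b\left(\frac{|G|}{\log |G|}\right)^{1/4},$$ then $C$ is a maximal supplement in $G$.
   Context: For subsets $A,B$ of an abelian group $G$, $A+B=\{a+b\}$ and $A-B=\{a-b : a\in A, b\in B\}$. A subset $C \subseteq G$ is a supplement for $W \subseteq G$ if the translates $c + W$, $c \in C$, are pairwise disjoint (every $g \in G$ has at most one representation $g = w + c$ with $w \in W$, $c \in C$); it is a maximal supplement for $W$ if moreover no proper superset of $C$ is a supplement for $W$. $C$ is a maximal supplement in $G$ if it is a maximal supplement for some $W \subseteq G$. A subset $C \subseteq G$ is solid if there is no set $D \supsetneq C$ with $D - D = C - C$. $\log$ is the natural logarithm. -}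

module Defs where

open import Level using (0ℓ)
open import Data.Nat using (ℕ)
open import Data.Fin using (Fin)
open import Data.Fin.Subset using (Subset; _∈_; _⊂_)
open import Data.Product using (_×_; ∃)
open import Relation.Nullary using (¬_)
open import Relation.Binary.PropositionalEquality using (_≡_)
open import Algebra.Structures using (IsAbelianGroup)

-- A finite abelian group of order n, presented (up to isomorphism) on the
-- carrier Fin n, with propositional equality.
record FinAbGroup (n : ℕ) : Set where
  infixl 6 _+_ _-_
  field
    _+_ : Fin n → Fin n → Fin n
    0g  : Fin n
    -_  : Fin n → Fin n
    isAbelianGroup : IsAbelianGroup _≡_ _+_ 0g -_
  _-_ : Fin n → Fin n → Fin n
  x - y = x + (- y)

module _ {n : ℕ} (G : FinAbGroup n) where
  open FinAbGroup G

  IsSupplement : Subset n → Subset n → Set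
  IsSupplement W C = ∀ w w′ c c′ → w ∈ W → w′ ∈ W → c ∈ C → c′ ∈ C →
    w + c ≡ w′ + c′ → (w ≡ w′ × c ≡ c′)

  IsMaximalSupplementFor : Subset n → Subset n → Set
  IsMaximalSupplementFor W C =
    IsSupplement W C × (∀ D → C ⊂ D → ¬ IsSupplement W D)

  IsMaximalSupplement : Subset n → Set
  IsMaximalSupplement C = ∃ λ W → IsMaximalSupplementFor W C

  InDiff : Subset n → Fin n → Set
  InDiff A g = ∃ λ a → ∃ λ a′ → a ∈ A × a′ ∈ A × g ≡ a - a′

  SameDiff : Subset n → Subset n → Set
  SameDiff A B = ∀ g → (InDiff A g → InDiff B g) × (InDiff B g → InDiff A g)

  IsSolid : Subset n → Set
  IsSolid C = ∀ D → C ⊂ D → ¬ SameDiff D C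

{-# OPTIONS --safe #-}

-- Put S = C − C and s = |C|². If a finite W satisfies (W − W) ∩ S = {0} and
-- W − W ⊇ G ∖ S, then C is a maximal supplement for W: any supplement E ⊋ C of W
-- satisfies E − E ⊆ S, hence E − E = C − C, against solidity.
--
-- W is built greedily, with Θ(n/s) points. A point is free if it lies outside W + S;
-- at least half of the group is always free. The next free point is chosen to control
-- two potentials at once: Σ_u 2^(number of representations of u as a difference of W),
-- and the number of u ∉ S not yet represented. On average over the free points the
-- first grows by a factor 1 + O(|W|/n); since log n is at most a small multiple of
-- n/s², this bounds every multiplicity by O(n/s²). So, for u ∉ S, only O(n/s) points of
-- W + u are not free, with a constant making this a small fraction of |W| once |W|
-- is half its final size. From then on a free point represents a given missing u with
-- probability Ω(|W|/n) = Ω(1/s), and Θ(n/s) such steps bring the second potential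
-- below n 2^(-Ω(n/s²)) < 1.
module Submission where

open import Defs
open import Data.Nat hiding (_≟_; _/_)
open import Data.Nat.Properties hiding (_≟_)
import Data.Nat.Properties as ℕ
open import Data.Nat.DivMod using (_/_; m≡m%n+[m/n]*n; m%n<n; m/n*n≤m)
open import Data.Nat.Solver using (module +-*-Solver)
open import Data.Bool using (true; false; if_then_else_)
open import Data.Fin using (Fin; zero; suc; _≟_)
open import Data.Fin.Permutation using (permutation)
open import Data.Fin.Properties using (any?; suc-injective)
open import Data.Fin.Subset using (Subset; Nonempty; ∣_∣; _∈_; _⊂_; inside; outside)
open import Data.List using (List; []; _∷_; length)
open import Data.Vec using ([]; _∷_; lookup; tabulate)
open import Data.Vec.Properties using (lookup∘tabulate; lookup⇒[]=; []=⇒lookup)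
open import Data.Product using (Σ; _×_; _,_; ∃; proj₂)
open import Data.Sum using (_⊎_; inj₁; inj₂)
open import Data.Unit using (⊤; tt)
open import Data.Empty using (⊥-elim)
open import Function using (_∘_)
open import Algebra.Bundles using (AbelianGroup)
import Algebra.Properties.AbelianGroup as AbelianGroupProperties
open import Algebra.Properties.Semiring.Sum +-*-semiring
  using (sum; ∑-distrib-+; ∑-comm; sum-cong-≗; *-distribˡ-sum; *-distribʳ-sum; sum-permute)
open import Relation.Nullary using (¬_; yes; no; does; ¬?; _×-dec_)
open import Relation.Nullary.Decidable using (dec-true; dec-false)
open import Relation.Binary.PropositionalEquality hiding ([_])
open +-*-Solver using (solve; _:+_; _:*_; _:=_; con)

-- Powers of ratios close to one, with denominators cleared

-- In the form `(1 + 1/v)^j ≤ 1 + 2j/v`, one more factor adds `1/v + 2j/v²`, and `2j ≤ v` bounds the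
-- cross term by `1/v`.
^-suc≤ : ∀ v j → 2 * j ≤ v → v * suc v ^ j ≤ v ^ j * (v + 2 * j)
^-suc≤ v zero    _    = ≤-reflexive (solve 1 (λ v → v :* con 1 := con 1 :* (v :+ con 0)) refl v)
^-suc≤ v (suc j) 2j≤v = begin
  v * (suc v * suc v ^ j)           ≡⟨ solve 2 (λ v p → v :* ((con 1 :+ v) :* p) := (con 1 :+ v) :* (v :* p)) refl v (suc v ^ j) ⟩
  suc v * (v * suc v ^ j)           ≤⟨ *-monoʳ-≤ (suc v) (^-suc≤ v j (≤-trans (*-monoʳ-≤ 2 (n≤1+n j)) 2j≤v)) ⟩
  suc v * (v ^ j * (v + 2 * j))     ≡⟨ solve 3 (λ v p j → (con 1 :+ v) :* (p :* (v :+ con 2 :* j)) := p :* (v :* (v :+ con 2 :* j) :+ v :+ con 2 :* j)) refl v (v ^ j) j ⟩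
  v ^ j * (v * (v + 2 * j) + v + 2 * j)  ≤⟨ *-monoʳ-≤ (v ^ j) (+-monoʳ-≤ (v * (v + 2 * j) + v) (≤-trans (*-monoʳ-≤ 2 (n≤1+n j)) 2j≤v)) ⟩
  v ^ j * (v * (v + 2 * j) + v + v)  ≡⟨ solve 3 (λ v p j → p :* (v :* (v :+ con 2 :* j) :+ v :+ v) := v :* p :* (v :+ con 2 :* (con 1 :+ j))) refl v (v ^ j) j ⟩
  v ^ suc j * (v + 2 * suc j)       ∎
  where open ≤-Reasoning

bernoulli : ∀ v j → v ^ j * (v + j) ≤ v * suc v ^ j
bernoulli v zero    = ≤-reflexive (solve 1 (λ v → con 1 :* (v :+ con 0) := v :* con 1) refl v)
bernoulli v (suc j) = begin
  v * v ^ j * (v + suc j)                ≤⟨ m≤m+n _ (v ^ j * j) ⟩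
  v * v ^ j * (v + suc j) + v ^ j * j    ≡⟨ solve 3 (λ v p j → v :* p :* (v :+ (con 1 :+ j)) :+ p :* j := (con 1 :+ v) :* (p :* (v :+ j))) refl v (v ^ j) j ⟩
  suc v * (v ^ j * (v + j))              ≤⟨ *-monoʳ-≤ (suc v) (bernoulli v j) ⟩
  suc v * (v * suc v ^ j)                ≡⟨ solve 2 (λ v p → (con 1 :+ v) :* (v :* p) := v :* ((con 1 :+ v) :* p)) refl v (suc v ^ j) ⟩
  v * suc v ^ suc j                      ∎
  where open ≤-Reasoning

^-distribʳ-* : ∀ x y k → (x * y) ^ k ≡ x ^ k * y ^ k
^-distribʳ-* x y zero    = refl
^-distribʳ-* x y (suc k) = trans (cong (x * y *_) (^-distribʳ-* x y k))
  (solve 4 (λ x y p q → x :* y :* (p :* q) := x :* p :* (y :* q)) refl x y (x ^ k) (y ^ k))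

-- (1 + 1/2N)^N ≤ 2, transported to the ratio a/n.
pow-ratio≤2 : ∀ N a n → 1 ≤ N → 2 * N * a ≤ suc (2 * N) * n → a ^ N ≤ 2 * n ^ N
pow-ratio≤2 N@(suc _) a n _ le = *-cancelˡ-≤ ((2 * N) ^ N) ⦃ m^n≢0 (2 * N) N ⦄ (begin
  (2 * N) ^ N * a ^ N           ≡⟨ ^-distribʳ-* (2 * N) a N ⟨
  (2 * N * a) ^ N               ≤⟨ ^-monoˡ-≤ N le ⟩
  (suc (2 * N) * n) ^ N         ≡⟨ ^-distribʳ-* (suc (2 * N)) n N ⟩
  suc (2 * N) ^ N * n ^ N       ≤⟨ *-monoˡ-≤ (n ^ N) (*-cancelˡ-≤ (2 * N) (≤-trans (^-suc≤ (2 * N) N ≤-refl)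
                                     (≤-reflexive (solve 2 (λ p v → p :* (v :+ v) := v :* (p :* con 2)) refl ((2 * N) ^ N) (2 * N))))) ⟩
  (2 * N) ^ N * 2 * n ^ N       ≡⟨ *-assoc ((2 * N) ^ N) 2 (n ^ N) ⟩
  (2 * N) ^ N * (2 * n ^ N)     ∎)
  where open ≤-Reasoning

-- (1 + 1/v)^v ≥ 2, transported to the ratio c/n.
2≤pow-ratio : ∀ v c n → 1 ≤ v → suc v * n ≤ v * c → 2 * n ^ v ≤ c ^ v
2≤pow-ratio v@(suc _) c n _ le = *-cancelˡ-≤ (v ^ v) ⦃ m^n≢0 v v ⦄ (begin
  v ^ v * (2 * n ^ v)     ≡⟨ *-assoc (v ^ v) 2 (n ^ v) ⟨
  v ^ v * 2 * n ^ v       ≤⟨ *-monoˡ-≤ (n ^ v) (*-cancelˡ-≤ v (≤-trans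
                               (≤-reflexive (solve 2 (λ p v → v :* (p :* con 2) := p :* (v :+ v)) refl (v ^ v) v)) (bernoulli v v))) ⟩
  suc v ^ v * n ^ v       ≡⟨ ^-distribʳ-* (suc v) n v ⟨
  (suc v * n) ^ v         ≤⟨ ^-monoˡ-≤ v le ⟩
  (v * c) ^ v             ≡⟨ ^-distribʳ-* v c v ⟩
  v ^ v * c ^ v           ∎)
  where open ≤-Reasoning

pow-pow-≤ : ∀ N e a n → a ^ N ≤ 2 * n ^ N → a ^ (N * e) ≤ 2 ^ e * n ^ (N * e)
pow-pow-≤ N e a n le = begin
  a ^ (N * e)              ≡⟨ ^-*-assoc a N e ⟨
  (a ^ N) ^ e              ≤⟨ ^-monoˡ-≤ e le ⟩
  (2 * n ^ N) ^ e          ≡⟨ ^-distribʳ-* 2 (n ^ N) e ⟩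
  2 ^ e * (n ^ N) ^ e      ≡⟨ cong (2 ^ e *_) (^-*-assoc n N e) ⟩
  2 ^ e * n ^ (N * e)      ∎
  where open ≤-Reasoning

pow-pow-≥ : ∀ v f c n → 2 * n ^ v ≤ c ^ v → 2 ^ f * n ^ (v * f) ≤ c ^ (v * f)
pow-pow-≥ v f c n le = begin
  2 ^ f * n ^ (v * f)      ≡⟨ cong (2 ^ f *_) (^-*-assoc n v f) ⟨
  2 ^ f * (n ^ v) ^ f      ≡⟨ ^-distribʳ-* 2 (n ^ v) f ⟨
  (2 * n ^ v) ^ f          ≤⟨ ^-monoˡ-≤ f le ⟩
  (c ^ v) ^ f              ≡⟨ ^-*-assoc c v f ⟩
  c ^ (v * f)              ∎
  where open ≤-Reasoning

-- n − h ≤ n²/(n + h), so the upper bound 2^f n^m ≤ (n + h)^m inverts.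
pow-decay : ∀ f m h n → 1 ≤ n → h ≤ n → 2 ^ f * n ^ m ≤ (n + h) ^ m → 2 ^ f * (n ∸ h) ^ m ≤ n ^ m
pow-decay f m h n@(suc _) _ h≤n le = *-cancelˡ-≤ (n ^ m) ⦃ m^n≢0 n m ⦄ (begin
  n ^ m * (2 ^ f * b ^ m)     ≡⟨ solve 3 (λ x y z → x :* (y :* z) := y :* x :* z) refl (n ^ m) (2 ^ f) (b ^ m) ⟩
  2 ^ f * n ^ m * b ^ m       ≤⟨ *-monoˡ-≤ (b ^ m) le ⟩
  (n + h) ^ m * b ^ m         ≡⟨ ^-distribʳ-* (n + h) b m ⟨
  ((n + h) * b) ^ m           ≤⟨ ^-monoˡ-≤ m (begin
     (n + h) * b             ≡⟨ cong (λ z → (z + h) * b) (m∸n+n≡m h≤n) ⟨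
     (b + h + h) * b         ≤⟨ m≤m+n _ (h * h) ⟩
     (b + h + h) * b + h * h ≡⟨ solve 2 (λ b h → (b :+ h :+ h) :* b :+ h :* h := (b :+ h) :* (b :+ h)) refl b h ⟩
     (b + h) * (b + h)       ≡⟨ cong (λ z → z * z) (m∸n+n≡m h≤n) ⟩
     n * n                   ∎) ⟩
  (n * n) ^ m                 ≡⟨ ^-distribʳ-* n n m ⟩
  n ^ m * n ^ m               ∎)
  where open ≤-Reasoning
        b = n ∸ h

-- As `a/n ≥ 1`, its powers increase, so a bound valid at the last step `m` is valid at every
-- earlier step.
pow-ratio-mono : ∀ c a n m j → 1 ≤ n → n ≤ a → j ≤ m → a ^ m ≤ c * n ^ m → a ^ j ≤ c * n ^ j
pow-ratio-mono c a n@(suc _) m j _ n≤a j≤m le = *-cancelʳ-≤ _ _ (n ^ (m ∸ j)) ⦃ m^n≢0 n (m ∸ j) ⦄ (begin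
  a ^ j * n ^ (m ∸ j)         ≤⟨ *-monoʳ-≤ (a ^ j) (^-monoˡ-≤ (m ∸ j) n≤a) ⟩
  a ^ j * a ^ (m ∸ j)         ≡⟨ ^-distribˡ-+-* a j (m ∸ j) ⟨
  a ^ (j + (m ∸ j))           ≡⟨ cong (a ^_) (m+[n∸m]≡n j≤m) ⟩
  a ^ m                       ≤⟨ le ⟩
  c * n ^ m                   ≡⟨ cong (λ z → c * n ^ z) (m+[n∸m]≡n j≤m) ⟨
  c * n ^ (j + (m ∸ j))       ≡⟨ cong (c *_) (^-distribˡ-+-* n j (m ∸ j)) ⟩
  c * (n ^ j * n ^ (m ∸ j))   ≡⟨ *-assoc c (n ^ j) _ ⟨
  c * n ^ j * n ^ (m ∸ j)     ∎)
  where open ≤-Reasoning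

-- Finite sums and averaging

sum-mono-≤ : ∀ {n} {f g : Fin n → ℕ} → (∀ i → f i ≤ g i) → sum f ≤ sum g
sum-mono-≤ {zero}  f≤g = z≤n
sum-mono-≤ {suc n} f≤g = +-mono-≤ (f≤g zero) (sum-mono-≤ (f≤g ∘ suc))

term≤sum : ∀ {n} (f : Fin n → ℕ) i → f i ≤ sum f
term≤sum f zero    = m≤m+n _ _
term≤sum f (suc i) = ≤-trans (term≤sum (f ∘ suc) i) (m≤n+m _ _)

sum-const : ∀ n c → sum {n} (λ _ → c) ≡ n * c
sum-const zero    c = refl
sum-const (suc n) c = cong (c +_) (sum-const n c)

-- First moment argument: if `F` exceeded `T` wherever `α` is nonzero, the weighted sum would be too
-- large. With `α` the indicator of the free points, `α x ≢ 0` makes the chosen point free.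
weighted-average : ∀ {n} (α F : Fin n → ℕ) T → 1 ≤ sum α →
  sum (λ x → α x * F x) ≤ sum α * T → ∃ λ x → α x ≢ 0 × F x ≤ T
weighted-average α F T 1≤α le with any? (λ x → ¬? (α x ℕ.≟ 0) ×-dec (F x ≤? T))
... | yes found = found
... | no  none  = ⊥-elim (<-irrefl refl (begin-strict
  sum α * T                    <⟨ *-monoʳ-< (sum α) ⦃ >-nonZero 1≤α ⦄ (n<1+n T) ⟩
  sum α * suc T                ≡⟨ *-distribʳ-sum (suc T) α ⟩
  sum (λ x → α x * suc T)      ≤⟨ sum-mono-≤ large ⟩
  sum (λ x → α x * F x)        ≤⟨ le ⟩
  sum α * T                    ∎))
  where
  open ≤-Reasoning
  large : ∀ x → α x * suc T ≤ α x * F x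
  large x with α x in eq
  ... | zero  = z≤n
  ... | suc k = *-monoʳ-≤ (suc k) (≰⇒> λ F≤T → none (x , (λ eq′ → 1+n≢0 (trans (sym eq) eq′)) , F≤T))

-- The indicator of zero, and counting along lists

-- Numerical form of "not blocked" and "not represented", so that both conditions can be summed over
-- the group.
δ₀ : ℕ → ℕ
δ₀ zero    = 1
δ₀ (suc _) = 0

δ₀-+ : ∀ p q → δ₀ (p + q) ≡ δ₀ p * δ₀ q
δ₀-+ zero    q = sym (+-identityʳ (δ₀ q))
δ₀-+ (suc p) q = refl

1≤δ₀+ : ∀ p → 1 ≤ δ₀ p + p
1≤δ₀+ zero    = s≤s z≤n
1≤δ₀+ (suc p) = s≤s z≤n

δ₀≢0 : ∀ p → δ₀ p ≢ 0 → p ≡ 0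
δ₀≢0 zero    _ = refl
δ₀≢0 (suc p) h = ⊥-elim (h refl)

δ₀≤1 : ∀ p → δ₀ p ≤ 1
δ₀≤1 zero    = ≤-refl
δ₀≤1 (suc p) = z≤n

module _ {n : ℕ} where

  [_≡_] : Fin n → Fin n → ℕ
  [ x ≡ y ] = if does (x ≟ y) then 1 else 0

  []-true : ∀ {x y : Fin n} → x ≡ y → [ x ≡ y ] ≡ 1
  []-true {x} {y} p = cong (if_then 1 else 0) (dec-true (x ≟ y) p)

  []-false : ∀ {x y : Fin n} → x ≢ y → [ x ≡ y ] ≡ 0
  []-false {x} {y} p = cong (if_then 1 else 0) (dec-false (x ≟ y) p)

  []-cong : ∀ {x y x′ y′ : Fin n} → (x ≡ y → x′ ≡ y′) → (x′ ≡ y′ → x ≡ y) → [ x ≡ y ] ≡ [ x′ ≡ y′ ]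
  []-cong {x} {y} to from with x ≟ y
  ... | yes p = sym ([]-true (to p))
  ... | no ¬p = sym ([]-false (¬p ∘ from))

  count : List (Fin n) → Fin n → ℕ
  count []       y = 0
  count (x ∷ xs) y = [ x ≡ y ] + count xs y

  ∑ₗ : List (Fin n) → (Fin n → ℕ) → ℕ
  ∑ₗ []       f = 0
  ∑ₗ (x ∷ xs) f = f x + ∑ₗ xs f

  ∑ₗ-+ : ∀ xs f g → ∑ₗ xs (λ x → f x + g x) ≡ ∑ₗ xs f + ∑ₗ xs g
  ∑ₗ-+ []       f g = refl
  ∑ₗ-+ (x ∷ xs) f g = trans (cong (f x + g x +_) (∑ₗ-+ xs f g))
    (solve 4 (λ a b c d → a :+ b :+ (c :+ d) := a :+ c :+ (b :+ d)) refl (f x) (g x) (∑ₗ xs f) (∑ₗ xs g))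

  ∑ₗ-const : ∀ xs c → ∑ₗ xs (λ _ → c) ≡ length xs * c
  ∑ₗ-const []       c = refl
  ∑ₗ-const (x ∷ xs) c = cong (c +_) (∑ₗ-const xs c)

  ∑ₗ-cong : ∀ xs {f g} → (∀ x → f x ≡ g x) → ∑ₗ xs f ≡ ∑ₗ xs g
  ∑ₗ-cong []       h = refl
  ∑ₗ-cong (x ∷ xs) h = cong₂ _+_ (h x) (∑ₗ-cong xs h)

  sum-∑ₗ-comm : ∀ {m} xs (f : Fin m → Fin n → ℕ) → sum (λ i → ∑ₗ xs (f i)) ≡ ∑ₗ xs (λ x → sum (λ i → f i x))
  sum-∑ₗ-comm {m} []       f = trans (sum-const m 0) (*-zeroʳ m)
  sum-∑ₗ-comm     (x ∷ xs) f = trans (∑-distrib-+ (λ i → f i x) (λ i → ∑ₗ xs (f i)))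
    (cong (sum (λ i → f i x) +_) (sum-∑ₗ-comm xs f))

sum-[] : ∀ {n} (f : Fin n → ℕ) a → sum (λ x → f x * [ a ≡ x ]) ≡ f a
sum-[] {suc n} f zero = trans (cong₂ _+_ (*-identityʳ (f zero))
  (trans (sum-cong-≗ (λ i → *-zeroʳ (f (suc i)))) (trans (sum-const n 0) (*-zeroʳ n)))) (+-identityʳ _)
sum-[] {suc n} f (suc a) = cong₂ _+_ (*-zeroʳ (f zero))
  (trans (sum-cong-≗ (λ i → cong (f (suc i) *_) ([]-suc i))) (sum-[] (f ∘ suc) a))
  where
  []-suc : ∀ i → [ suc a ≡ suc i ] ≡ [ a ≡ i ]
  []-suc i with a ≟ i
  ... | yes _ = refl
  ... | no _  = refl

-- The two implications say that `ψ` inverts `φ`, so an entry `w` of the list is counted at the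
-- single point `x = ψ w`. This is the change of variables behind every double count below.
sum-count : ∀ {n} (f : Fin n → ℕ) (φ ψ : Fin n → Fin n) → (∀ w x → w ≡ φ x → ψ w ≡ x) → (∀ w x → ψ w ≡ x → w ≡ φ x) →
  ∀ xs → sum (λ x → f x * count xs (φ x)) ≡ ∑ₗ xs (f ∘ ψ)
sum-count {n} f φ ψ to from [] = trans (sum-cong-≗ (λ i → *-zeroʳ (f i))) (trans (sum-const n 0) (*-zeroʳ n))
sum-count f φ ψ to from (w ∷ xs) = begin
  sum (λ x → f x * ([ w ≡ φ x ] + count xs (φ x)))
    ≡⟨ sum-cong-≗ (λ x → trans (*-distribˡ-+ (f x) [ w ≡ φ x ] _) (cong (λ z → f x * z + _) ([]-cong (to w x) (from w x)))) ⟩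
  sum (λ x → f x * [ ψ w ≡ x ] + f x * count xs (φ x))
    ≡⟨ ∑-distrib-+ (λ x → f x * [ ψ w ≡ x ]) _ ⟩
  sum (λ x → f x * [ ψ w ≡ x ]) + sum (λ x → f x * count xs (φ x))
    ≡⟨ cong₂ _+_ (sum-[] f (ψ w)) (sum-count f φ ψ to from xs) ⟩
  f (ψ w) + ∑ₗ xs (f ∘ ψ) ∎
  where open ≡-Reasoning

-- Group identities

module _ {n : ℕ} (G : FinAbGroup n) where
  open FinAbGroup G renaming (_+_ to _⊕_; _-_ to _⊖_; -_ to ⊖_)

  abelianGroup : AbelianGroup _ _
  abelianGroup = record { isAbelianGroup = isAbelianGroup }
  open AbelianGroup abelianGroup using () renaming (assoc to ⊕-assoc; comm to ⊕-comm; inverseʳ to ⊕-inverseʳ) public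
  open AbelianGroupProperties abelianGroup using (//-rightDividesˡ; //-rightDividesʳ; ⁻¹-anti-homo‿-; xyx⁻¹≈y) public

  ≡⊖⇒⊕≡ : ∀ {x y z} → x ≡ y ⊖ z → x ⊕ z ≡ y
  ≡⊖⇒⊕≡ {x} {y} {z} p = trans (cong (_⊕ z) p) (//-rightDividesˡ z y)

  ⊕≡⇒≡⊖ : ∀ {x y z} → x ⊕ z ≡ y → x ≡ y ⊖ z
  ⊕≡⇒≡⊖ {x} {y} {z} p = trans (sym (//-rightDividesʳ z x)) (cong (_⊖ z) p)

  sum-translate : ∀ (f : Fin n → ℕ) w → sum (λ x → f (x ⊖ w)) ≡ sum f
  sum-translate f w = sym (sum-permute f (permutation (_⊖ w) (_⊕ w) (λ x → //-rightDividesʳ w x) (λ x → //-rightDividesˡ w x)))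

  -- With the three lemmas that follow, this gives the two changes of variable of `clash-rep`: for
  -- fixed `y` and `u`, the equations `(y + u) − w = x` and `(w + u) − y = x` are solved for `w`.
  ⊖⊖⇒ : ∀ {w x y u} → w ≡ y ⊖ (x ⊖ u) → (y ⊕ u) ⊖ w ≡ x
  ⊖⊖⇒ {w} {x} {y} {u} p = sym (⊕≡⇒≡⊖ (trans (⊕-comm x w) (≡⊖-shift (≡⊖⇒⊕≡ p))))
    where ≡⊖-shift : w ⊕ (x ⊖ u) ≡ y → w ⊕ x ≡ y ⊕ u
          ≡⊖-shift q = sym (≡⊖⇒⊕≡ (sym (trans (⊕-assoc w x (⊖ u)) q)))

  ⇒⊖⊖ : ∀ {w x y u} → (y ⊕ u) ⊖ w ≡ x → w ≡ y ⊖ (x ⊖ u)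
  ⇒⊖⊖ {w} {x} {y} {u} p = ⊕≡⇒≡⊖ (trans (sym (⊕-assoc w x (⊖ u)))
    (sym (⊕≡⇒≡⊖ (sym (trans (⊕-comm w x) (≡⊖⇒⊕≡ (sym p)))))))

  ⊖⊖⇒′ : ∀ {w x y u} → w ≡ y ⊖ (u ⊖ x) → (w ⊕ u) ⊖ y ≡ x
  ⊖⊖⇒′ {w} {x} {y} {u} p = sym (⊕≡⇒≡⊖ (trans (⊕-comm x y)
    (≡⊖⇒⊕≡ (sym (trans (⊕-assoc w u (⊖ x)) (≡⊖⇒⊕≡ p))))))

  ⇒⊖⊖′ : ∀ {w x y u} → (w ⊕ u) ⊖ y ≡ x → w ≡ y ⊖ (u ⊖ x)
  ⇒⊖⊖′ {w} {x} {y} {u} p = ⊕≡⇒≡⊖ (trans (sym (⊕-assoc w u (⊖ x)))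
    (sym (⊕≡⇒≡⊖ (trans (⊕-comm y x) (≡⊖⇒⊕≡ (sym p))))))

-- Free points, the two potentials, and one greedy step

-- D stands for the multiplicity function of the difference set S, so sum D is s and
-- u ∉ S reads D u ≡ 0.
module _ {n : ℕ} (G : FinAbGroup n) (D : Fin n → ℕ) where
  open FinAbGroup G renaming (_+_ to _⊕_; _-_ to _⊖_; -_ to ⊖_)

  -- Only differences of a later by an earlier point are counted, so that adding a
  -- point increases rep by at most 1.
  rep : List (Fin n) → Fin n → ℕ
  rep []       u = 0
  rep (x ∷ xs) u = rep xs u + count xs (x ⊖ u)

  -- Zero exactly when `x` lies outside `W + S`. Keeping multiplicities makes its total over the
  -- group equal to `length xs * sum D`.
  blocked : List (Fin n) → Fin n → ℕ
  blocked xs x = ∑ₗ xs (λ w → D (x ⊖ w))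

  Independent : List (Fin n) → Set
  Independent []       = ⊤
  Independent (x ∷ xs) = blocked xs x ≡ 0 × Independent xs

  free : List (Fin n) → Fin n → ℕ
  free xs x = δ₀ (blocked xs x)

  weight missed : List (Fin n) → ℕ
  weight xs = sum (λ u → 2 ^ rep xs u)
  missed xs = sum (λ u → δ₀ (D u) * δ₀ (rep xs u))

  -- An upper bound for the number of points of `W + u` that are not free: pairs `w`, `w′` with
  -- `w + u − w′` in `S`, weighted by `D`.
  clash : List (Fin n) → Fin n → ℕ
  clash xs u = ∑ₗ xs (λ w → blocked xs (w ⊕ u))

  sum-blocked : ∀ xs → sum (blocked xs) ≡ length xs * sum D
  sum-blocked xs = begin
    sum (blocked xs)                         ≡⟨ sum-∑ₗ-comm xs (λ x w → D (x ⊖ w)) ⟩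
    ∑ₗ xs (λ w → sum (λ x → D (x ⊖ w)))      ≡⟨ ∑ₗ-cong xs (sum-translate G D) ⟩
    ∑ₗ xs (λ _ → sum D)                      ≡⟨ ∑ₗ-const xs (sum D) ⟩
    length xs * sum D                        ∎
    where open ≡-Reasoning

  n≤free+blocked : ∀ xs → n ≤ sum (free xs) + length xs * sum D
  n≤free+blocked xs = begin
    n                                        ≡⟨ trans (sum-const n 1) (*-identityʳ n) ⟨
    sum {n} (λ _ → 1)                        ≤⟨ sum-mono-≤ (λ x → 1≤δ₀+ (blocked xs x)) ⟩
    sum (λ x → free xs x + blocked xs x)     ≡⟨ ∑-distrib-+ (free xs) (blocked xs) ⟩
    sum (free xs) + sum (blocked xs)         ≡⟨ cong (sum (free xs) +_) (sum-blocked xs) ⟩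
    sum (free xs) + length xs * sum D        ∎
    where open ≤-Reasoning

  free≤n : ∀ xs → sum (free xs) ≤ n
  free≤n xs = ≤-trans (sum-mono-≤ (λ x → δ₀≤1 (blocked xs x))) (≤-reflexive (trans (sum-const n 1) (*-identityʳ n)))

  sum-count-translate : ∀ xs u → sum (λ x → count xs (x ⊖ u)) ≡ length xs
  sum-count-translate xs u = begin
    sum (λ x → count xs (x ⊖ u))             ≡⟨ sum-cong-≗ (λ x → +-identityʳ (count xs (x ⊖ u))) ⟨
    sum (λ x → 1 * count xs (x ⊖ u))         ≡⟨ sum-count (λ _ → 1) (_⊖ u) (_⊕ u) (λ w x → ≡⊖⇒⊕≡ G) (λ w x → ⊕≡⇒≡⊖ G) xs ⟩
    ∑ₗ xs (λ _ → 1)                          ≡⟨ ∑ₗ-const xs 1 ⟩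
    length xs * 1                            ≡⟨ *-identityʳ (length xs) ⟩
    length xs                                ∎
    where open ≡-Reasoning

  -- Sort the pairs by `σ = w + u − w′`. A list entry paired with itself contributes `D u`, which is
  -- zero. Otherwise one point was added later: the later minus the earlier is `σ − u` if that point
  -- is `w`, and `u − σ` if it is `w′`.
  clash-rep : ∀ xs u → D u ≡ 0 → clash xs u ≡ sum (λ σ → D σ * (rep xs (σ ⊖ u) + rep xs (u ⊖ σ)))
  clash-rep []       u Du≡0 = sym (trans (sum-cong-≗ (λ σ → *-zeroʳ (D σ))) (trans (sum-const n 0) (*-zeroʳ n)))
  clash-rep (y ∷ xs) u Du≡0 = begin
    D ((y ⊕ u) ⊖ y) + blocked xs (y ⊕ u) + ∑ₗ xs (λ w → D ((w ⊕ u) ⊖ y) + blocked xs (w ⊕ u))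
      ≡⟨ cong₂ (λ a b → a + blocked xs (y ⊕ u) + b) (trans (cong D (xyx⁻¹≈y G y u)) Du≡0) (∑ₗ-+ xs _ _) ⟩
    blocked xs (y ⊕ u) + (∑ₗ xs (λ w → D ((w ⊕ u) ⊖ y)) + clash xs u)
      ≡⟨ cong₂ (λ a b → a + (b + clash xs u))
           (sum-count D (λ σ → y ⊖ (σ ⊖ u)) (λ w → (y ⊕ u) ⊖ w) (λ w x → ⊖⊖⇒ G) (λ w x → ⇒⊖⊖ G) xs)
           (sum-count D (λ σ → y ⊖ (u ⊖ σ)) (λ w → (w ⊕ u) ⊖ y) (λ w x → ⊖⊖⇒′ G) (λ w x → ⇒⊖⊖′ G) xs) ⟨
    sum p + (sum q + clash xs u)
      ≡⟨ cong (λ a → sum p + (sum q + a)) (clash-rep xs u Du≡0) ⟩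
    sum p + (sum q + sum (λ σ → D σ * (rep xs (σ ⊖ u) + rep xs (u ⊖ σ))))
      ≡⟨ trans (∑-distrib-+ p _) (cong (sum p +_) (∑-distrib-+ q _)) ⟨
    sum (λ σ → p σ + (q σ + D σ * (rep xs (σ ⊖ u) + rep xs (u ⊖ σ))))
      ≡⟨ sum-cong-≗ (λ σ → solve 5 (λ d a b r t → d :* a :+ (d :* b :+ d :* (r :+ t)) := d :* (r :+ a :+ (t :+ b))) refl
           (D σ) (count xs (y ⊖ (σ ⊖ u))) (count xs (y ⊖ (u ⊖ σ))) (rep xs (σ ⊖ u)) (rep xs (u ⊖ σ))) ⟩
    sum (λ σ → D σ * (rep (y ∷ xs) (σ ⊖ u) + rep (y ∷ xs) (u ⊖ σ))) ∎
    where
    open ≡-Reasoning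
    p q : Fin n → ℕ
    p σ = D σ * count xs (y ⊖ (σ ⊖ u))
    q σ = D σ * count xs (y ⊖ (u ⊖ σ))

  clash≤ : ∀ xs r → (∀ u → rep xs u ≤ r) → ∀ u → D u ≡ 0 → clash xs u ≤ sum D * (r + r)
  clash≤ xs r rep≤r u Du≡0 = begin
    clash xs u                                                   ≡⟨ clash-rep xs u Du≡0 ⟩
    sum (λ σ → D σ * (rep xs (σ ⊖ u) + rep xs (u ⊖ σ)))          ≤⟨ sum-mono-≤ (λ σ → *-monoʳ-≤ (D σ) (+-mono-≤ (rep≤r _) (rep≤r _))) ⟩
    sum (λ σ → D σ * (r + r))                                    ≡⟨ *-distribʳ-sum (r + r) D ⟨
    sum D * (r + r)                                              ∎
    where open ≤-Reasoning

  -- Each point of `W + u` is free or blocked. The free ones are the choices of `x` that would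
  -- represent `u` as `x − w`.
  length≤free+clash : ∀ xs u → length xs ≤ sum (λ x → free xs x * count xs (x ⊖ u)) + clash xs u
  length≤free+clash xs u = begin
    length xs                                                    ≡⟨ sum-count-translate xs u ⟨
    sum (λ x → count xs (x ⊖ u))                                 ≤⟨ sum-mono-≤ (λ x → ≤-trans (≤-reflexive (sym (*-identityˡ _)))
                                                                      (*-monoˡ-≤ (count xs (x ⊖ u)) (1≤δ₀+ (blocked xs x)))) ⟩
    sum (λ x → (free xs x + blocked xs x) * count xs (x ⊖ u))    ≡⟨ sum-cong-≗ (λ x → *-distribʳ-+ (count xs (x ⊖ u)) (free xs x) _) ⟩
    sum (λ x → free xs x * count xs (x ⊖ u) + blocked xs x * count xs (x ⊖ u))
                                                                 ≡⟨ ∑-distrib-+ (λ x → free xs x * count xs (x ⊖ u)) _ ⟩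
    sum (λ x → free xs x * count xs (x ⊖ u)) + sum (λ x → blocked xs x * count xs (x ⊖ u))
                                                                 ≡⟨ cong (sum (λ x → free xs x * count xs (x ⊖ u)) +_) (sum-count (blocked xs) (_⊖ u) (_⊕ u) (λ w x → ≡⊖⇒⊕≡ G) (λ w x → ⊕≡⇒≡⊖ G) xs) ⟩
    sum (λ x → free xs x * count xs (x ⊖ u)) + clash xs u        ∎
    where open ≤-Reasoning

  module _ (1≤D0 : 1 ≤ D 0g) where

    count≤blocked : ∀ xs y → count xs y ≤ blocked xs y
    count≤blocked []       y = z≤n
    count≤blocked (x ∷ xs) y = +-mono-≤ first (count≤blocked xs y)
      where
      first : [ x ≡ y ] ≤ D (y ⊖ x)
      first with x ≟ y
      ... | yes refl = ≤-trans 1≤D0 (≤-reflexive (cong D (sym (⊕-inverseʳ G x))))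
      ... | no _     = z≤n

    -- Since `0` is in `S`, a point of the list blocks itself and is never chosen again. Hence a new
    -- point raises each `rep` by at most 1.
    count≤1 : ∀ xs → Independent xs → ∀ y → count xs y ≤ 1
    count≤1 []       _          y = z≤n
    count≤1 (x ∷ xs) (b , ind) y with x ≟ y
    ... | yes refl = +-monoʳ-≤ 1 (≤-trans (count≤blocked xs x) (≤-reflexive b))
    ... | no _     = count≤1 xs ind y

    -- Exchange the sums. A new `x` at most doubles the term of `u`, and only if `x − u` is in `W`,
    -- which happens for `length xs` points `x` in all, free or not.
    sum-weight : ∀ xs → Independent xs →
      sum (λ x → free xs x * weight (x ∷ xs)) ≤ (sum (free xs) + length xs) * weight xs
    sum-weight xs ind = begin
      sum (λ x → free xs x * sum (λ u → 2 ^ rep (x ∷ xs) u))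
        ≤⟨ sum-mono-≤ (λ x → ≤-trans (≤-reflexive (*-distribˡ-sum {n} (free xs x) (λ u → 2 ^ rep (x ∷ xs) u))) (sum-mono-≤ (λ u → pointwise x u))) ⟩
      sum (λ x → sum (λ u → 2 ^ rep xs u * (free xs x + count xs (x ⊖ u))))
        ≡⟨ ∑-comm (λ x u → 2 ^ rep xs u * (free xs x + count xs (x ⊖ u))) ⟩
      sum (λ u → sum (λ x → 2 ^ rep xs u * (free xs x + count xs (x ⊖ u))))
        ≡⟨ sum-cong-≗ (λ u → sym (*-distribˡ-sum {n} (2 ^ rep xs u) (λ x → free xs x + count xs (x ⊖ u)))) ⟩
      sum (λ u → 2 ^ rep xs u * sum (λ x → free xs x + count xs (x ⊖ u)))
        ≡⟨ sum-cong-≗ (λ u → cong (2 ^ rep xs u *_) (trans (∑-distrib-+ (free xs) _) (cong (sum (free xs) +_) (sum-count-translate xs u)))) ⟩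
      sum (λ u → 2 ^ rep xs u * (sum (free xs) + length xs))
        ≡⟨ *-distribʳ-sum (sum (free xs) + length xs) (λ u → 2 ^ rep xs u) ⟨
      weight xs * (sum (free xs) + length xs)
        ≡⟨ *-comm (weight xs) _ ⟩
      (sum (free xs) + length xs) * weight xs ∎
      where
      open ≤-Reasoning
      2^c≤1+c : ∀ c → c ≤ 1 → 2 ^ c ≤ 1 + c
      2^c≤1+c zero       _ = ≤-refl
      2^c≤1+c (suc zero) _ = ≤-refl
      2^c≤1+c (suc (suc c)) (s≤s ())
      pointwise : ∀ x u → free xs x * 2 ^ rep (x ∷ xs) u ≤ 2 ^ rep xs u * (free xs x + count xs (x ⊖ u))
      pointwise x u = begin
        free xs x * 2 ^ (rep xs u + c)         ≡⟨ cong (free xs x *_) (^-distribˡ-+-* 2 (rep xs u) c) ⟩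
        free xs x * (2 ^ rep xs u * 2 ^ c)     ≤⟨ *-monoʳ-≤ (free xs x) (*-monoʳ-≤ (2 ^ rep xs u) (2^c≤1+c c (count≤1 xs ind _))) ⟩
        free xs x * (2 ^ rep xs u * (1 + c))   ≡⟨ solve 3 (λ f p c → f :* (p :* (con 1 :+ c)) := p :* (f :+ f :* c)) refl (free xs x) (2 ^ rep xs u) c ⟩
        2 ^ rep xs u * (free xs x + free xs x * c) ≤⟨ *-monoʳ-≤ (2 ^ rep xs u) (+-monoʳ-≤ (free xs x)
                                                       (≤-trans (*-monoˡ-≤ c (δ₀≤1 (blocked xs x))) (≤-reflexive (*-identityˡ c)))) ⟩
        2 ^ rep xs u * (free xs x + c)         ∎
        where c = count xs (x ⊖ u)

    -- For a missing `u`, a free `x` either leaves `u` missing or represents it, and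
    -- `length≤free+clash` supplies at least `h` free points of the second kind. Elements of `S`
    -- have no term in `missed`, so `h` need only be valid outside `S`.
    sum-missed : ∀ xs → Independent xs → ∀ h → (∀ u → D u ≡ 0 → h ≤ length xs ∸ clash xs u) →
      sum (λ x → free xs x * missed (x ∷ xs)) + h * missed xs ≤ sum (free xs) * missed xs
    sum-missed xs ind h h≤ = begin
      sum (λ x → free xs x * missed (x ∷ xs)) + h * missed xs
        ≡⟨ cong₂ _+_ (sum-cong-≗ (λ x → *-distribˡ-sum {n} (free xs x) (λ u → δ₀ (D u) * δ₀ (rep (x ∷ xs) u)))) (*-distribˡ-sum {n} h y) ⟩
      sum (λ x → sum (λ u → free xs x * (δ₀ (D u) * δ₀ (rep (x ∷ xs) u)))) + sum (λ u → h * y u)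
        ≡⟨ cong (_+ sum (λ u → h * y u)) (∑-comm (λ x u → free xs x * (δ₀ (D u) * δ₀ (rep (x ∷ xs) u)))) ⟩
      sum (λ u → sum (λ x → free xs x * (δ₀ (D u) * δ₀ (rep (x ∷ xs) u)))) + sum (λ u → h * y u)
        ≡⟨ ∑-distrib-+ (λ u → sum (λ x → free xs x * (δ₀ (D u) * δ₀ (rep (x ∷ xs) u)))) _ ⟨
      sum (λ u → sum (λ x → free xs x * (δ₀ (D u) * δ₀ (rep (x ∷ xs) u))) + h * y u)
        ≤⟨ sum-mono-≤ pointwise ⟩
      sum (λ u → sum (free xs) * y u)
        ≡⟨ *-distribˡ-sum (sum (free xs)) y ⟨
      sum (free xs) * missed xs ∎
      where
      open ≤-Reasoning
      y : Fin n → ℕ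
      y u = δ₀ (D u) * δ₀ (rep xs u)
      hit : ∀ u → h * y u ≤ sum (λ x → free xs x * count xs (x ⊖ u)) * y u
      hit u with D u in eq
      ... | zero  = *-monoˡ-≤ (1 * δ₀ (rep xs u)) (≤-trans (h≤ u eq) (m≤n+o⇒m∸n≤o (length xs) (clash xs u) (≤-trans (length≤free+clash xs u) (≤-reflexive (+-comm (sum (λ x → free xs x * count xs (x ⊖ u))) (clash xs u))))))
      ... | suc _ = ≤-reflexive (trans (*-zeroʳ h) (sym (*-zeroʳ (sum (λ x → free xs x * count xs (x ⊖ u))))))
      δ₀-count : ∀ c → c ≤ 1 → δ₀ c + c ≡ 1
      δ₀-count zero          _ = refl
      δ₀-count (suc zero)    _ = refl
      δ₀-count (suc (suc _)) (s≤s ())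
      pointwise : ∀ u → sum (λ x → free xs x * (δ₀ (D u) * δ₀ (rep (x ∷ xs) u))) + h * y u ≤ sum (free xs) * y u
      pointwise u = begin
        sum (λ x → free xs x * (δ₀ (D u) * δ₀ (rep xs u + c x))) + h * y u
          ≤⟨ +-mono-≤ (≤-reflexive (sum-cong-≗ (λ x → trans (cong (λ z → free xs x * (δ₀ (D u) * z)) (δ₀-+ (rep xs u) (c x)))
               (solve 4 (λ f d r c → f :* (d :* (r :* c)) := f :* c :* (d :* r)) refl (free xs x) (δ₀ (D u)) (δ₀ (rep xs u)) (δ₀ (c x)))))) (hit u) ⟩
        sum (λ x → free xs x * δ₀ (c x) * y u) + sum (λ x → free xs x * c x) * y u
          ≡⟨ cong (_+ sum (λ x → free xs x * c x) * y u) (*-distribʳ-sum (y u) (λ x → free xs x * δ₀ (c x))) ⟨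
        sum (λ x → free xs x * δ₀ (c x)) * y u + sum (λ x → free xs x * c x) * y u
          ≡⟨ *-distribʳ-+ (y u) (sum (λ x → free xs x * δ₀ (c x))) _ ⟨
        (sum (λ x → free xs x * δ₀ (c x)) + sum (λ x → free xs x * c x)) * y u
          ≡⟨ cong (_* y u) (trans (sym (∑-distrib-+ (λ x → free xs x * δ₀ (c x)) _))
               (sum-cong-≗ (λ x → trans (sym (*-distribˡ-+ (free xs x) (δ₀ (c x)) (c x)))
                 (trans (cong (free xs x *_) (δ₀-count (c x) (count≤1 xs ind _))) (*-identityʳ (free xs x)))))) ⟩
        sum (free xs) * y u ∎
        where
        c : Fin n → ℕ
        c x = count xs (x ⊖ u)

    -- Average over the `A` free points. By `few`, `A ≥ n/2`, so the mean weight grows by at most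
    -- `1 + i/A ≤ 1 + 2i/n ≤ a/n`; by `A ≤ n`, the mean of `missed` shrinks by at least `1 − h/n`.
    -- One `x` is no worse than the mean of the combination with coefficients `P` and `Q`.
    step : ∀ xs → Independent xs → 1 ≤ n → 2 * (length xs * sum D) ≤ n →
      ∀ a → n + 2 * length xs ≤ a → ∀ h → (∀ u → D u ≡ 0 → h ≤ length xs ∸ clash xs u) → ∀ P Q →
      ∃ λ x → blocked xs x ≡ 0 ×
        n * (P * weight (x ∷ xs) + Q * missed (x ∷ xs)) ≤ P * (a * weight xs) + Q * ((n ∸ h) * missed xs)
    step xs ind 1≤n few a a≥ h h≤ P Q =
      let x , fx≢0 , le = weighted-average (free xs) F T 1≤A average in x , δ₀≢0 _ fx≢0 , le
      where
      open ≤-Reasoning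
      A = sum (free xs)
      X = weight xs
      Y = missed xs
      i = length xs
      F : Fin n → ℕ
      F x = n * (P * weight (x ∷ xs) + Q * missed (x ∷ xs))
      T = P * (a * X) + Q * ((n ∸ h) * Y)
      n≤2A : n ≤ 2 * A
      n≤2A = +-cancelʳ-≤ n n (2 * A) (begin
        n + n                          ≡⟨ solve 1 (λ n → n :+ n := con 2 :* n) refl n ⟩
        2 * n                          ≤⟨ *-monoʳ-≤ 2 (n≤free+blocked xs) ⟩
        2 * (A + i * sum D)            ≡⟨ *-distribˡ-+ 2 A _ ⟩
        2 * A + 2 * (i * sum D)        ≤⟨ +-monoʳ-≤ (2 * A) few ⟩
        2 * A + n                      ∎)
      1≤A : 1 ≤ A
      1≤A with A | n≤2A
      ... | zero  | n≤0 = ⊥-elim (<-irrefl refl (≤-trans 1≤n n≤0))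
      ... | suc _ | _   = s≤s z≤n
      boundX : n * sum (λ x → free xs x * weight (x ∷ xs)) ≤ A * (a * X)
      boundX = begin
        n * sum (λ x → free xs x * weight (x ∷ xs))  ≤⟨ *-monoʳ-≤ n (sum-weight xs ind) ⟩
        n * ((A + i) * X)                          ≡⟨ solve 4 (λ n A i X → n :* ((A :+ i) :* X) := (n :* A :+ n :* i) :* X) refl n A i X ⟩
        (n * A + n * i) * X                        ≤⟨ *-monoˡ-≤ X (+-monoʳ-≤ (n * A) (*-monoˡ-≤ i n≤2A)) ⟩
        (n * A + 2 * A * i) * X                    ≡⟨ solve 4 (λ n A i X → (n :* A :+ con 2 :* A :* i) :* X := A :* ((n :+ con 2 :* i) :* X)) refl n A i X ⟩
        A * ((n + 2 * i) * X)                      ≤⟨ *-monoʳ-≤ A (*-monoˡ-≤ X a≥) ⟩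
        A * (a * X)                                ∎
      boundY : n * sum (λ x → free xs x * missed (x ∷ xs)) ≤ A * ((n ∸ h) * Y)
      boundY = begin
        n * S                                      ≤⟨ m+n≤o⇒m≤o∸n (n * S) (begin
           n * S + A * h * Y                     ≤⟨ +-monoʳ-≤ (n * S) (*-monoˡ-≤ Y (*-monoˡ-≤ h (free≤n xs))) ⟩
           n * S + n * h * Y                     ≡⟨ solve 4 (λ n S h Y → n :* S :+ n :* h :* Y := n :* (S :+ h :* Y)) refl n S h Y ⟩
           n * (S + h * Y)                       ≤⟨ *-monoʳ-≤ n (sum-missed xs ind h h≤) ⟩
           n * (A * Y)                           ≡⟨ solve 3 (λ n A Y → n :* (A :* Y) := A :* n :* Y) refl n A Y ⟩
           A * n * Y                             ∎) ⟩
        A * n * Y ∸ A * h * Y                      ≡⟨ *-distribʳ-∸ Y (A * n) (A * h) ⟨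
        (A * n ∸ A * h) * Y                        ≡⟨ cong (_* Y) (*-distribˡ-∸ A n h) ⟨
        A * (n ∸ h) * Y                            ≡⟨ *-assoc A (n ∸ h) Y ⟩
        A * ((n ∸ h) * Y)                          ∎
        where S = sum (λ x → free xs x * missed (x ∷ xs))
      average : sum (λ x → free xs x * F x) ≤ A * T
      average = begin
        sum (λ x → free xs x * F x)
          ≡⟨ sum-cong-≗ (λ x → solve 6 (λ f n P Q X Y → f :* (n :* (P :* X :+ Q :* Y)) := P :* n :* (f :* X) :+ Q :* n :* (f :* Y)) refl
               (free xs x) n P Q (weight (x ∷ xs)) (missed (x ∷ xs))) ⟩
        sum (λ x → P * n * (free xs x * weight (x ∷ xs)) + Q * n * (free xs x * missed (x ∷ xs)))
          ≡⟨ ∑-distrib-+ (λ x → P * n * (free xs x * weight (x ∷ xs))) _ ⟩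
        sum (λ x → P * n * (free xs x * weight (x ∷ xs))) + sum (λ x → Q * n * (free xs x * missed (x ∷ xs)))
          ≡⟨ cong₂ _+_ (*-distribˡ-sum {n} (P * n) (λ x → free xs x * weight (x ∷ xs))) (*-distribˡ-sum {n} (Q * n) (λ x → free xs x * missed (x ∷ xs))) ⟨
        P * n * sum (λ x → free xs x * weight (x ∷ xs)) + Q * n * sum (λ x → free xs x * missed (x ∷ xs))
          ≡⟨ cong₂ _+_ (*-assoc P n _) (*-assoc Q n _) ⟩
        P * (n * sum (λ x → free xs x * weight (x ∷ xs))) + Q * (n * sum (λ x → free xs x * missed (x ∷ xs)))
          ≤⟨ +-mono-≤ (*-monoʳ-≤ P boundX) (*-monoʳ-≤ Q boundY) ⟩
        P * (A * (a * X)) + Q * (A * ((n ∸ h) * Y))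
          ≡⟨ solve 5 (λ P Q A x y → P :* (A :* x) :+ Q :* (A :* y) := A :* (P :* x :+ Q :* y)) refl P Q A (a * X) ((n ∸ h) * Y) ⟩
        A * T ∎

-- The two halves of the greedy construction

module _ {n : ℕ} (G : FinAbGroup n) (D : Fin n → ℕ) where
  open FinAbGroup G using (0g)

  module _ (1≤D0 : 1 ≤ D 0g) where

    -- First half of the construction, whose purpose is a list long enough to make later
    -- representations likely. The weight starts at `n` and grows by a factor of at most `a/n` per
    -- point.
    independent-list : ∀ a m → 1 ≤ n → 2 * (m * sum D) ≤ n → n + 2 * m ≤ a →
      ∃ λ xs → Independent G D xs × length xs ≡ m × n ^ m * weight G D xs ≤ a ^ m * n
    independent-list a zero    1≤n few a≥ = [] , tt , refl ,
      ≤-reflexive (cong (_+ 0) (trans (sum-const n 1) (*-identityʳ n)))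
    independent-list a (suc m) 1≤n few a≥ =
      let xs , ind , len , bound = independent-list a m 1≤n few′ a≥′
          -- `h = 0` and `Q = 0` switch off the second potential.
          x , free , le = step G D 1≤D0 xs ind 1≤n (subst (λ i → 2 * (i * sum D) ≤ n) (sym len) few′)
                            a (subst (λ i → n + 2 * i ≤ a) (sym len) a≥′) 0 (λ _ _ → z≤n) 1 0
      in x ∷ xs , (free , ind) , cong suc len , extend (weight G D xs) (weight G D (x ∷ xs)) bound le
      where
      few′ : 2 * (m * sum D) ≤ n
      few′ = ≤-trans (*-monoʳ-≤ 2 (*-monoˡ-≤ (sum D) (n≤1+n m))) few
      a≥′ : n + 2 * m ≤ a
      a≥′ = ≤-trans (+-monoʳ-≤ n (*-monoʳ-≤ 2 (n≤1+n m))) a≥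
      extend : ∀ X X′ → n ^ m * X ≤ a ^ m * n → n * (1 * X′ + 0) ≤ 1 * (a * X) + 0 → n ^ suc m * X′ ≤ a ^ suc m * n
      extend X X′ bound le = begin
        n ^ suc m * X′             ≡⟨ solve 3 (λ n p x → n :* p :* x := p :* (n :* (con 1 :* x :+ con 0))) refl n (n ^ m) X′ ⟩
        n ^ m * (n * (1 * X′ + 0)) ≤⟨ *-monoʳ-≤ (n ^ m) le ⟩
        n ^ m * (1 * (a * X) + 0)  ≡⟨ solve 3 (λ a p x → p :* (con 1 :* (a :* x) :+ con 0) := a :* (p :* x)) refl a (n ^ m) X ⟩
        a * (n ^ m * X)            ≤⟨ *-monoʳ-≤ a bound ⟩
        a * (a ^ m * n)            ≡⟨ *-assoc a (a ^ m) n ⟨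
        a ^ suc m * n              ∎
        where open ≤-Reasoning

    2^-cancel-≤ : ∀ p r → 2 ^ p ≤ 2 ^ r → p ≤ r
    2^-cancel-≤ p r le = ≮⇒≥ λ r<p → <-irrefl refl (<-≤-trans (^-monoʳ-< 2 (s≤s (s≤s z≤n)) r<p) le)

    -- `a/n` bounds the growth of the weight per point and `c` its growth over `m` points; `r` will
    -- bound all multiplicities. By `room`, `m` points outnumber the possible clashes by `h`, which
    -- is then the number of free points sure to represent a given missing element.
    module _ (a c h m r : ℕ) (1≤n : 1 ≤ n) (1≤c : 1 ≤ c) (h<n : h < n)
             (few : 2 * ((m + m) * sum D) ≤ n) (a≥ : n + 2 * (m + m) ≤ a)
             (a^m≤ : a ^ m ≤ c * n ^ m) (r≥ : c * (2 * (c * n)) ≤ 2 ^ r)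
             (room : sum D * (r + r) + h ≤ m) where

      -- `b/n` is the decay rate of `missed`. `Z` bounds the combined potential at the start of the
      -- second half: `c * n` for the weight, and `c` times at most `n` missed elements.
      b Z : ℕ
      b = n ∸ h
      Z = 2 * (c * n)

      1≤b : 1 ≤ b
      1≤b = m<n⇒0<n∸m h<n

      n≤a : n ≤ a
      n≤a = ≤-trans (m≤m+n n _) a≥

      1≤a : 1 ≤ a
      1≤a = ≤-trans 1≤n n≤a

      -- The two potentials, each divided by its expected rate: (a/n)^j for the weight
      -- and (b/n)^j for the missed points. The factor c makes them comparable at j = 0.
      Good : ℕ → List (Fin n) → Set
      Good j xs = Independent G D xs × length xs ≡ m + j ×
        n ^ j * (b ^ j * weight G D xs + a ^ j * (c * missed G D xs)) ≤ (a * b) ^ j * Z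

      -- Dropping the missed part of the potential leaves `weight ≤ (a/n)^j Z`, and `(a/n)^j ≤ c`
      -- because `j ≤ m`.
      weight≤2^r : ∀ j xs → j ≤ m → Good j xs → weight G D xs ≤ 2 ^ r
      weight≤2^r j xs j≤m (_ , _ , le) = ≤-trans
        (*-cancelˡ-≤ (n ^ j) ⦃ m^n≢0 n j ⦃ >-nonZero 1≤n ⦄ ⦄ (*-cancelˡ-≤ (b ^ j) ⦃ m^n≢0 b j ⦃ >-nonZero 1≤b ⦄ ⦄ (begin
          b ^ j * (n ^ j * X)                    ≤⟨ m≤m+n _ _ ⟩
          b ^ j * (n ^ j * X) + n ^ j * (a ^ j * (c * Y))
                                                 ≡⟨ solve 4 (λ p q x y → p :* (q :* x) :+ q :* y := q :* (p :* x :+ y)) refl (b ^ j) (n ^ j) X (a ^ j * (c * Y)) ⟩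
          n ^ j * (b ^ j * X + a ^ j * (c * Y))  ≤⟨ le ⟩
          (a * b) ^ j * Z                        ≡⟨ cong (_* Z) (^-distribʳ-* a b j) ⟩
          a ^ j * b ^ j * Z                      ≤⟨ *-monoˡ-≤ Z (*-monoˡ-≤ (b ^ j) (pow-ratio-mono c a n m j 1≤n n≤a j≤m a^m≤)) ⟩
          c * n ^ j * b ^ j * Z                  ≡⟨ solve 4 (λ c p q z → c :* p :* q :* z := q :* (p :* (c :* z))) refl c (n ^ j) (b ^ j) Z ⟩
          b ^ j * (n ^ j * (c * Z))              ∎))) r≥
        where
        open ≤-Reasoning
        X = weight G D xs
        Y = missed G D xs

      start : ∀ xs → n ^ m * weight G D xs ≤ a ^ m * n →
        n ^ 0 * (b ^ 0 * weight G D xs + a ^ 0 * (c * missed G D xs)) ≤ (a * b) ^ 0 * Z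
      start xs bound = begin
        1 * (1 * X + 1 * (c * Y))   ≡⟨ solve 2 (λ x y → con 1 :* (con 1 :* x :+ con 1 :* y) := x :+ y) refl X (c * Y) ⟩
        X + c * Y                   ≤⟨ +-mono-≤ X≤ (*-monoʳ-≤ c Y≤) ⟩
        c * n + c * n               ≡⟨ solve 1 (λ z → z :+ z := con 1 :* (con 2 :* z)) refl (c * n) ⟩
        1 * Z                       ∎
        where
        open ≤-Reasoning
        X = weight G D xs
        Y = missed G D xs
        X≤ : X ≤ c * n
        X≤ = *-cancelˡ-≤ (n ^ m) ⦃ m^n≢0 n m ⦃ >-nonZero 1≤n ⦄ ⦄ (begin
          n ^ m * X        ≤⟨ bound ⟩
          a ^ m * n        ≤⟨ *-monoˡ-≤ n a^m≤ ⟩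
          c * n ^ m * n    ≡⟨ solve 3 (λ c p n → c :* p :* n := p :* (c :* n)) refl c (n ^ m) n ⟩
          n ^ m * (c * n)  ∎)
        Y≤ : Y ≤ n
        Y≤ = ≤-trans (sum-mono-≤ {n} {g = λ _ → 1} (λ u → *-mono-≤ (δ₀≤1 (D u)) (δ₀≤1 (rep G D xs u))))
                     (≤-reflexive (trans (sum-const n 1) (*-identityʳ n)))

      extend : ∀ j X Y X′ Y′ → n ^ j * (b ^ j * X + a ^ j * (c * Y)) ≤ (a * b) ^ j * Z →
        n * (b ^ suc j * X′ + a ^ suc j * c * Y′) ≤ b ^ suc j * (a * X) + a ^ suc j * c * (b * Y) →
        n ^ suc j * (b ^ suc j * X′ + a ^ suc j * (c * Y′)) ≤ (a * b) ^ suc j * Z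
      extend j X Y X′ Y′ bound le = begin
        n * n ^ j * (b ^ suc j * X′ + a ^ suc j * (c * Y′))
          ≡⟨ solve 7 (λ n p B A c x y → n :* p :* (B :* x :+ A :* (c :* y)) := p :* (n :* (B :* x :+ A :* c :* y))) refl n (n ^ j) (b ^ suc j) (a ^ suc j) c X′ Y′ ⟩
        n ^ j * (n * (b ^ suc j * X′ + a ^ suc j * c * Y′))
          ≤⟨ *-monoʳ-≤ (n ^ j) le ⟩
        n ^ j * (b * b ^ j * (a * X) + a * a ^ j * c * (b * Y))
          ≡⟨ solve 8 (λ p a b A B c x y → p :* (b :* B :* (a :* x) :+ a :* A :* c :* (b :* y)) := a :* b :* (p :* (B :* x :+ A :* (c :* y)))) refl
               (n ^ j) a b (a ^ j) (b ^ j) c X Y ⟩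
        a * b * (n ^ j * (b ^ j * X + a ^ j * (c * Y)))
          ≤⟨ *-monoʳ-≤ (a * b) bound ⟩
        a * b * ((a * b) ^ j * Z)
          ≡⟨ *-assoc (a * b) _ Z ⟨
        (a * b) ^ suc j * Z ∎
        where open ≤-Reasoning

      -- The first half already supplies `m` points. Each `2 ^ rep` is a single term of the weight,
      -- so multiplicities are at most `r`, clashes at most `2r * sum D`, and `room` leaves `h`. The
      -- decay of `missed` thus rests on the weight bound within the same induction.
      gain : ∀ j xs → j ≤ m → Good j xs → ∀ u → D u ≡ 0 → h ≤ length xs ∸ clash G D xs u
      gain j xs j≤m good@(_ , len , _) u Du≡0 = m+n≤o⇒m≤o∸n h (begin
        h + clash G D xs u          ≤⟨ +-monoʳ-≤ h (clash≤ G D xs r rep≤r u Du≡0) ⟩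
        h + sum D * (r + r)         ≡⟨ +-comm h _ ⟩
        sum D * (r + r) + h         ≤⟨ room ⟩
        m                           ≤⟨ m≤m+n m j ⟩
        m + j                       ≡⟨ len ⟨
        length xs                   ∎)
        where
        open ≤-Reasoning
        rep≤r : ∀ u → rep G D xs u ≤ r
        rep≤r u = 2^-cancel-≤ _ _ (≤-trans (term≤sum (λ v → 2 ^ rep G D xs v) u) (weight≤2^r j xs j≤m good))

      good-list : ∀ j → j ≤ m → ∃ (Good j)
      good-list zero j≤m =
        let xs , ind , len , bound = independent-list a m 1≤n (≤-trans (*-monoʳ-≤ 2 (*-monoˡ-≤ (sum D) (m≤m+n m m))) few)
                                            (≤-trans (+-monoʳ-≤ n (*-monoʳ-≤ 2 (m≤m+n m m))) a≥)
        in xs , ind , trans len (sym (+-identityʳ m)) , start xs bound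
      good-list (suc j) j<m =
        let xs , good@(ind , len , bound) = good-list j (<⇒≤ j<m)
            len≤ = ≤-trans (≤-reflexive len) (+-monoʳ-≤ m (<⇒≤ j<m))
            x , free , le = step G D 1≤D0 xs ind 1≤n
                              (≤-trans (*-monoʳ-≤ 2 (*-monoˡ-≤ (sum D) len≤)) few)
                              a (≤-trans (+-monoʳ-≤ n (*-monoʳ-≤ 2 len≤)) a≥)
                              -- With these coefficients both parts of the bound from `step` equal
                              -- `a * b` times the corresponding parts of the potential at `j`.
                              h (gain j xs (<⇒≤ j<m) good) (b ^ suc j) (a ^ suc j * c)
        in x ∷ xs , (free , ind) , trans (cong suc len) (sym (+-suc m j)) ,
           extend j (weight G D xs) (missed G D xs) (weight G D (x ∷ xs)) (missed G D (x ∷ xs)) bound le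

      -- After the second half, `missed ≤ 2n (b/n)^m ≤ 2n / 2^f < 1`, whereas an unrepresented `u`
      -- outside `S` would contribute 1.
      saturated : ∀ f → 2 * n < 2 ^ f → 2 ^ f * n ^ m ≤ (n + h) ^ m →
        ∃ λ xs → Independent G D xs × (∀ u → D u ≡ 0 → rep G D xs u ≢ 0)
      saturated f 2n<2^f decay with good-list m ≤-refl
      ... | xs , good@(ind , _ , bound) = xs , ind , λ u Du≡0 rep≡0 → <-irrefl refl (begin-strict
        2 ^ f * b ^ m                          ≤⟨ pow-decay f m h n 1≤n (<⇒≤ h<n) decay ⟩
        n ^ m                                  ≡⟨ *-identityʳ (n ^ m) ⟨
        n ^ m * 1                              ≤⟨ *-monoʳ-≤ (n ^ m) (≤-trans (≤-reflexive (sym (cong₂ (λ p q → δ₀ p * δ₀ q) Du≡0 rep≡0)))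
                                                    (term≤sum (λ v → δ₀ (D v) * δ₀ (rep G D xs v)) u)) ⟩
        n ^ m * Y                              ≤⟨ *-cancelˡ-≤ (a ^ m * c) ⦃ m*n≢0 (a ^ m) c ⦃ m^n≢0 a m ⦃ >-nonZero 1≤a ⦄ ⦄ ⦃ >-nonZero 1≤c ⦄ ⦄ cancelled ⟩
        2 * n * b ^ m                          <⟨ *-monoˡ-< (b ^ m) ⦃ m^n≢0 b m ⦃ >-nonZero 1≤b ⦄ ⦄ 2n<2^f ⟩
        2 ^ f * b ^ m                          ∎)
        where
        open ≤-Reasoning
        X = weight G D xs
        Y = missed G D xs
        cancelled : a ^ m * c * (n ^ m * Y) ≤ a ^ m * c * (2 * n * b ^ m)
        cancelled = begin
          a ^ m * c * (n ^ m * Y)                ≤⟨ m≤n+m _ _ ⟩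
          n ^ m * (b ^ m * X) + a ^ m * c * (n ^ m * Y)
                                                 ≡⟨ solve 5 (λ p x A c y → p :* x :+ A :* c :* (p :* y) := p :* (x :+ A :* (c :* y))) refl (n ^ m) (b ^ m * X) (a ^ m) c Y ⟩
          n ^ m * (b ^ m * X + a ^ m * (c * Y))  ≤⟨ bound ⟩
          (a * b) ^ m * Z                        ≡⟨ cong (_* Z) (^-distribʳ-* a b m) ⟩
          a ^ m * b ^ m * (2 * (c * n))          ≡⟨ solve 4 (λ A B c n → A :* B :* (con 2 :* (c :* n)) := A :* c :* (con 2 :* n :* B)) refl (a ^ m) (b ^ m) c n ⟩
          a ^ m * c * (2 * n * b ^ m)            ∎

    -- Each half of the construction has m = 512 s f steps. The constants are chosen so
    -- that (1 + 4m/n)^m ≤ 2^(32 f), that h = m/2 leaves room for 2 s · 96 f clashes, and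
    -- that (1 + h/n)^m ≥ 2^f beats the initial number n of missed points.
    covering : ∀ f → 1 ≤ n → 1 ≤ f → 4 * n < 2 ^ f → let s = sum D ; t = 16 * s in
      8 * (t * t * 32) * f ≤ n → n ≤ 2 * (8 * (t * t * 32) * f) →
      ∃ λ xs → Independent G D xs × (∀ u → D u ≡ 0 → rep G D xs u ≢ 0)
    covering f 1≤n 1≤f 4n<2^f lower upper =
      -- In `r = 3e`, the two factors `c = 2^e` account for `2e`, and `2n < 2^f ≤ 2^e` for the third
      -- `e`.
      saturated a (2 ^ e) h m (e + e + e) 1≤n (m^n>0 2 e) h<n few ≤-refl a^m≤ r≥ room f 2n<2^f decay
      where
      open ≤-Reasoning
      s t e m h a : ℕ
      s = sum D
      t = 16 * s
      e = 32 * f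
      m = t * e
      h = 8 * s * e
      a = n + 2 * (m + m)
      1≤s : 1 ≤ s
      1≤s = ≤-trans 1≤D0 (term≤sum D 0g)
      1≤t : 1 ≤ t
      1≤t = *-mono-≤ {1} {16} (s≤s z≤n) 1≤s
      f≤e : f ≤ e
      f≤e = m≤m+n f _
      lower′ : 8 * (t * t * e) ≤ n
      lower′ = ≤-trans (≤-reflexive (solve 3 (λ t f c → con 8 :* (t :* t :* (c :* f)) := con 8 :* (t :* t :* c) :* f) refl t f 32)) lower
      2n<2^f : 2 * n < 2 ^ f
      2n<2^f = ≤-<-trans (*-monoˡ-≤ n {2} {4} (s≤s (s≤s z≤n))) 4n<2^f
      t≤tt : t ≤ t * t
      t≤tt = ≤-trans (≤-reflexive (sym (*-identityʳ t))) (*-monoʳ-≤ t 1≤t)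
      1≤h : 1 ≤ h
      1≤h = *-mono-≤ (*-mono-≤ {1} {8} (s≤s z≤n) 1≤s) (≤-trans 1≤f f≤e)
      2h≡m : h + h ≡ m
      2h≡m = solve 2 (λ s e → con 8 :* s :* e :+ con 8 :* s :* e := con 16 :* s :* e) refl s e
      m≤n : m ≤ n
      m≤n = begin
        t * e               ≤⟨ *-monoˡ-≤ e t≤tt ⟩
        t * t * e           ≤⟨ m≤m+n _ _ ⟩
        8 * (t * t * e)     ≤⟨ lower′ ⟩
        n                   ∎
      h<n : h < n
      h<n = begin-strict
        h                   <⟨ m<m+n h 1≤h ⟩
        h + h               ≡⟨ 2h≡m ⟩
        m                   ≤⟨ m≤n ⟩
        n                   ∎
      few : 2 * ((m + m) * s) ≤ n
      few = begin
        2 * ((m + m) * s)   ≤⟨ *-monoʳ-≤ 2 (*-monoʳ-≤ (m + m) (m≤m+n s _)) ⟩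
        2 * ((m + m) * t)   ≤⟨ m≤m+n _ (4 * (t * t * e)) ⟩
        2 * ((t * e + t * e) * t) + 4 * (t * t * e) ≡⟨ solve 2 (λ t e → con 2 :* ((t :* e :+ t :* e) :* t) :+ con 4 :* (t :* t :* e) := con 8 :* (t :* t :* e)) refl t e ⟩
        8 * (t * t * e)     ≤⟨ lower′ ⟩
        n                   ∎
      -- By `lower′`, `a/n ≤ 1 + 1/(2t)`, whose `t`-th power is at most 2; then `m = t * e`.
      a^m≤ : a ^ m ≤ 2 ^ e * n ^ m
      a^m≤ = pow-pow-≤ t e a n (pow-ratio≤2 t a n 1≤t (begin
        2 * t * (n + 2 * (t * e + t * e))     ≡⟨ solve 3 (λ t n e → con 2 :* t :* (n :+ con 2 :* (t :* e :+ t :* e)) := con 8 :* (t :* t :* e) :+ con 2 :* t :* n) refl t n e ⟩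
        8 * (t * t * e) + 2 * t * n           ≤⟨ +-monoˡ-≤ (2 * t * n) lower′ ⟩
        n + 2 * t * n                         ∎))
      r≥ : 2 ^ e * (2 * (2 ^ e * n)) ≤ 2 ^ (e + e + e)
      r≥ = begin
        2 ^ e * (2 * (2 ^ e * n))             ≡⟨ solve 2 (λ p n → p :* (con 2 :* (p :* n)) := p :* p :* (con 2 :* n)) refl (2 ^ e) n ⟩
        2 ^ e * 2 ^ e * (2 * n)               ≤⟨ *-monoʳ-≤ (2 ^ e * 2 ^ e) (≤-trans (<⇒≤ 2n<2^f) (^-monoʳ-≤ 2 f≤e)) ⟩
        2 ^ e * 2 ^ e * 2 ^ e                 ≡⟨ cong (_* 2 ^ e) (^-distribˡ-+-* 2 e e) ⟨
        2 ^ (e + e) * 2 ^ e                   ≡⟨ ^-distribˡ-+-* 2 (e + e) e ⟨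
        2 ^ (e + e + e)                       ∎
      room : s * (e + e + e + (e + e + e)) + h ≤ m
      room = ≤-trans (m≤m+n _ (2 * s * e)) (≤-reflexive
        (solve 2 (λ s e → s :* (e :+ e :+ e :+ (e :+ e :+ e)) :+ con 8 :* s :* e :+ con 2 :* s :* e := con 16 :* s :* e) refl s e))
      -- By `upper`, `h/n ≥ 1/(32t)`, so `(1 + h/n)^(32t) ≥ 2`; then `m = 32t * f`.
      decay : 2 ^ f * n ^ m ≤ (n + h) ^ m
      decay = subst (λ z → 2 ^ f * n ^ z ≤ (n + h) ^ z) (solve 3 (λ c t f → c :* t :* f := t :* (c :* f)) refl 32 t f)
        (pow-pow-≥ (32 * t) f (n + h) n (2≤pow-ratio (32 * t) (n + h) n (*-mono-≤ {1} {32} (s≤s z≤n) 1≤t) (begin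
          n + 32 * t * n                ≤⟨ +-monoˡ-≤ (32 * t * n) n≤32th ⟩
          32 * t * h + 32 * t * n       ≡⟨ solve 4 (λ c t h n → c :* t :* h :+ c :* t :* n := c :* t :* (n :+ h)) refl 32 t h n ⟩
          32 * t * (n + h)              ∎)))
        where
        n≤32th : n ≤ 32 * t * h
        n≤32th = begin
          n                             ≤⟨ upper ⟩
          2 * (8 * (t * t * 32) * f)    ≡⟨ solve 3 (λ c t f → con 2 :* (con 8 :* (t :* t :* c) :* f) := con 16 :* t :* (t :* (c :* f))) refl 32 t f ⟩
          16 * t * m                    ≡⟨ cong (16 * t *_) 2h≡m ⟨
          16 * t * (h + h)              ≡⟨ solve 2 (λ t h → con 16 :* t :* (h :+ h) := con 32 :* t :* h) refl t h ⟩
          32 * t * h                    ∎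

-- Subsets as indicator functions

sum≢0 : ∀ {n} (f : Fin n → ℕ) → sum f ≢ 0 → ∃ λ i → f i ≢ 0
sum≢0 {n} f h with any? (λ i → ¬? (f i ℕ.≟ 0))
... | yes found = found
... | no  none  = ⊥-elim (h (trans (sum-cong-≗ λ i → zero-at i (f i) refl) (trans (sum-const n 0) (*-zeroʳ n))))
  where
  zero-at : ∀ i k → f i ≡ k → f i ≡ 0
  zero-at i zero    eq = eq
  zero-at i (suc k) eq = ⊥-elim (none (i , λ eq′ → 1+n≢0 (trans (sym eq) eq′)))

χ : ∀ {n} → Subset n → Fin n → ℕ
χ p x = if lookup p x then 1 else 0

χ-∈ : ∀ {n} {p : Subset n} {x} → x ∈ p → χ p x ≡ 1
χ-∈ x∈p = cong (if_then 1 else 0) ([]=⇒lookup x∈p)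

χ≢0 : ∀ {n} (p : Subset n) x → χ p x ≢ 0 → x ∈ p
χ≢0 p x h with lookup p x in eq
... | true  = lookup⇒[]= x p eq
... | false = ⊥-elim (h refl)

sum-χ : ∀ {n} (p : Subset n) → sum (χ p) ≡ ∣ p ∣
sum-χ []            = refl
sum-χ (inside  ∷ p) = cong suc (sum-χ p)
sum-χ (outside ∷ p) = sum-χ p

support : ∀ {n} → (Fin n → ℕ) → Subset n
support f = tabulate λ x → does (¬? (f x ℕ.≟ 0))

∈-support⁺ : ∀ {n} (f : Fin n → ℕ) {x} → f x ≢ 0 → x ∈ support f
∈-support⁺ f {x} h = lookup⇒[]= x _ (trans (lookup∘tabulate _ x) (dec-true (¬? (f x ℕ.≟ 0)) h))

∈-support⁻ : ∀ {n} (f : Fin n → ℕ) {x} → x ∈ support f → f x ≢ 0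
∈-support⁻ f {x} x∈ fx≡0 with trans (sym (trans (lookup∘tabulate _ x) (dec-false (¬? (f x ℕ.≟ 0)) λ h → h fx≡0))) ([]=⇒lookup x∈)
... | ()

m*n≢0⇒ : ∀ m n → m * n ≢ 0 → m ≢ 0 × n ≢ 0
m*n≢0⇒ m n h = (λ m≡0 → h (cong (_* n) m≡0)) , (λ n≡0 → h (trans (cong (m *_) n≡0) (*-zeroʳ m)))

-- The difference set of `C`, and maximality from a covering list

module _ {n : ℕ} (G : FinAbGroup n) where
  open FinAbGroup G renaming (_+_ to _⊕_; _-_ to _⊖_; -_ to ⊖_)

  -- The number of representations of `g` as a difference of elements of `C`: its support is
  -- `C − C`, and its total is exactly the square of the size of `C`.
  diffs : Subset n → Fin n → ℕ
  diffs C g = sum λ c → χ C (g ⊕ c) * χ C c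

  diffs⇒InDiff : ∀ C g → diffs C g ≢ 0 → InDiff G C g
  diffs⇒InDiff C g h with sum≢0 _ h
  ... | c , hc with m*n≢0⇒ (χ C (g ⊕ c)) (χ C c) hc
  ... | h₁ , h₂ = g ⊕ c , c , χ≢0 C _ h₁ , χ≢0 C c h₂ , ⊕≡⇒≡⊖ G refl

  InDiff⇒1≤diffs : ∀ C g → InDiff G C g → 1 ≤ diffs C g
  InDiff⇒1≤diffs C g (a , a′ , a∈C , a′∈C , g≡) = ≤-trans
    (≤-reflexive (sym (cong₂ _*_ (trans (cong (χ C) (≡⊖⇒⊕≡ G g≡)) (χ-∈ a∈C)) (χ-∈ a′∈C))))
    (term≤sum (λ c → χ C (g ⊕ c) * χ C c) a′)

  sum-diffs : ∀ C → sum (diffs C) ≡ ∣ C ∣ * ∣ C ∣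
  sum-diffs C = begin
    sum (λ g → sum (λ c → χ C (g ⊕ c) * χ C c))   ≡⟨ ∑-comm (λ g c → χ C (g ⊕ c) * χ C c) ⟩
    sum (λ c → sum (λ g → χ C (g ⊕ c) * χ C c))   ≡⟨ sum-cong-≗ (λ c → *-distribʳ-sum {n} (χ C c) (λ g → χ C (g ⊕ c))) ⟨
    sum (λ c → sum (λ g → χ C (g ⊕ c)) * χ C c)   ≡⟨ sum-cong-≗ (λ c → cong (_* χ C c) (trans (sym
                                                       (sum-permute (χ C) (permutation (_⊕ c) (_⊖ c) (//-rightDividesˡ G c) (//-rightDividesʳ G c)))) (sum-χ C))) ⟩
    sum (λ c → ∣ C ∣ * χ C c)                     ≡⟨ *-distribˡ-sum ∣ C ∣ (χ C) ⟨
    ∣ C ∣ * sum (χ C)                             ≡⟨ cong (∣ C ∣ *_) (sum-χ C) ⟩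
    ∣ C ∣ * ∣ C ∣                                 ∎
    where open ≡-Reasoning

  -- `independent` keeps only one of `w − w′` and `w′ − w` out of `S`; the symmetry of `C − C`
  -- excludes the other.
  InDiff-neg : ∀ C x y → InDiff G C (x ⊖ y) → InDiff G C (y ⊖ x)
  InDiff-neg C x y (a , a′ , a∈ , a′∈ , eq) = a′ , a , a′∈ , a∈ ,
    trans (sym (⁻¹-anti-homo‿- G x y)) (trans (cong ⊖_ eq) (⁻¹-anti-homo‿- G a a′))

  rep⇒difference : ∀ D xs u → rep G D xs u ≢ 0 → ∃ λ w → ∃ λ w′ → count xs w ≢ 0 × count xs w′ ≢ 0 × u ≡ w ⊖ w′
  rep⇒difference D []       u h = ⊥-elim (h refl)
  rep⇒difference D (x ∷ xs) u h with count xs (x ⊖ u) ℕ.≟ 0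
  ... | no q = x , x ⊖ u ,
        (λ z → 1+n≢0 (trans (sym ([]-true {x = x} refl)) (m+n≡0⇒m≡0 [ x ≡ x ] z))) ,
        (λ z → q (m+n≡0⇒n≡0 [ x ≡ x ⊖ u ] z)) ,
        ⊕≡⇒≡⊖ G (trans (⊕-comm G u (x ⊖ u)) (//-rightDividesˡ G u x))
  ... | yes q with rep⇒difference D xs u (λ p → h (cong₂ _+_ p q))
  ... | w , w′ , hw , hw′ , eq = w , w′ , (λ z → hw (m+n≡0⇒n≡0 [ x ≡ w ] z)) , (λ z → hw′ (m+n≡0⇒n≡0 [ x ≡ w′ ] z)) , eq

  count-∷ : ∀ x xs (w : Fin n) → count (x ∷ xs) w ≢ 0 → x ≡ w ⊎ count xs w ≢ 0
  count-∷ x xs w h with x ≟ w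
  ... | yes p = inj₁ p
  ... | no _  = inj₂ h

  unblocked : ∀ D xs x → blocked G D xs x ≡ 0 → ∀ w → count xs w ≢ 0 → D (x ⊖ w) ≡ 0
  unblocked D []       x b w h = ⊥-elim (h refl)
  unblocked D (y ∷ xs) x b w h with count-∷ y xs w h
  ... | inj₁ refl = m+n≡0⇒m≡0 _ b
  ... | inj₂ h′   = unblocked D xs x (m+n≡0⇒n≡0 (D (x ⊖ y)) b) w h′

  independent : ∀ D xs → Independent G D xs → ∀ w w′ → count xs w ≢ 0 → count xs w′ ≢ 0 →
    w ≡ w′ ⊎ D (w ⊖ w′) ≡ 0 ⊎ D (w′ ⊖ w) ≡ 0
  independent D []       ind       w w′ h h′ = ⊥-elim (h refl)
  independent D (x ∷ xs) (b , ind) w w′ h h′ with count-∷ x xs w h | count-∷ x xs w′ h′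
  ... | inj₁ refl | inj₁ refl = inj₁ refl
  ... | inj₁ refl | inj₂ k′   = inj₂ (inj₁ (unblocked D xs x b w′ k′))
  ... | inj₂ k    | inj₁ refl = inj₂ (inj₂ (unblocked D xs x b w k))
  ... | inj₂ k    | inj₂ k′   = independent D xs ind w w′ k k′

  covering⇒maximal : ∀ C → Nonempty C → IsSolid G C → ∀ xs → Independent G (diffs C) xs →
    (∀ u → diffs C u ≡ 0 → rep G (diffs C) xs u ≢ 0) → IsMaximalSupplement G C
  covering⇒maximal C (c₀ , c₀∈C) solid xs ind cover = W , supplement , maximal
    where
    W = support (count xs)
    swap : ∀ {w w′ c c′} → w ⊕ c ≡ w′ ⊕ c′ → w ⊖ w′ ≡ c′ ⊖ c
    swap {w} {w′} {c} {c′} eq = ⊕≡⇒≡⊖ G (begin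
      (w ⊖ w′) ⊕ c           ≡⟨ ⊕-comm G (w ⊖ w′) c ⟩
      c ⊕ (w ⊖ w′)           ≡⟨ ⊕-assoc G c w (⊖ w′) ⟨
      (c ⊕ w) ⊖ w′           ≡⟨ cong (_⊖ w′) (trans (⊕-comm G c w) eq) ⟩
      (w′ ⊕ c′) ⊖ w′         ≡⟨ xyx⁻¹≈y G w′ c′ ⟩
      c′                     ∎)
      where open ≡-Reasoning
    unswap : ∀ {w w′ a a′} → a ⊖ a′ ≡ w ⊖ w′ → w′ ⊕ a ≡ w ⊕ a′
    unswap {w} {w′} {a} {a′} eq = begin
      w′ ⊕ a                 ≡⟨ cong (w′ ⊕_) (≡⊖⇒⊕≡ G (sym eq)) ⟨
      w′ ⊕ ((w ⊖ w′) ⊕ a′)   ≡⟨ ⊕-assoc G w′ (w ⊖ w′) a′ ⟨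
      (w′ ⊕ (w ⊖ w′)) ⊕ a′   ≡⟨ cong (_⊕ a′) (trans (⊕-comm G w′ (w ⊖ w′)) (//-rightDividesˡ G w′ w)) ⟩
      w ⊕ a′                 ∎
      where open ≡-Reasoning
    cancel : ∀ {w c c′} → w ⊕ c ≡ w ⊕ c′ → c ≡ c′
    cancel {w} {c} {c′} eq = trans (sym (xyx⁻¹≈y G w c)) (trans (cong (_⊖ w) eq) (xyx⁻¹≈y G w c′))
    conflict : ∀ g → diffs C g ≡ 0 → ¬ InDiff G C g
    conflict g z i = <-irrefl refl (≤-trans (InDiff⇒1≤diffs C g i) (≤-reflexive z))
    supplement : IsSupplement G W C
    supplement w w′ c c′ w∈ w′∈ c∈ c′∈ eq = w≡w′ , cancel (trans eq (cong (_⊕ c′) (sym w≡w′)))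
      where
      in-diff : InDiff G C (w ⊖ w′)
      in-diff = c′ , c , c′∈ , c∈ , swap eq
      w≡w′ : w ≡ w′
      w≡w′ with independent (diffs C) xs ind w w′ (∈-support⁻ (count xs) w∈) (∈-support⁻ (count xs) w′∈)
      ... | inj₁ p        = p
      ... | inj₂ (inj₁ z) = ⊥-elim (conflict _ z in-diff)
      ... | inj₂ (inj₂ z) = ⊥-elim (conflict _ z (InDiff-neg C w w′ in-diff))
    maximal : ∀ E → C ⊂ E → ¬ IsSupplement G W E
    maximal E C⊂E@(C⊆E , _) supp = solid E C⊂E λ g → E⇒C g ,
      λ { (a , a′ , a∈ , a′∈ , eq) → a , a′ , C⊆E a∈ , C⊆E a′∈ , eq }
      where
      E⇒C : ∀ g → InDiff G E g → InDiff G C g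
      E⇒C g (a , a′ , a∈ , a′∈ , g≡) with diffs C g ℕ.≟ 0
      ... | no ≢0 = diffs⇒InDiff C g ≢0
      ... | yes ≡0 with rep⇒difference (diffs C) xs g (cover g ≡0)
      -- Here `w + a′ = w′ + a`, so the supplement property of `E` forces `a = a′`. Then `g` is
      -- zero, a difference of `C` through `c₀ − c₀`.
      ... | w , w′ , hw , hw′ , g≡′ = c₀ , c₀ , c₀∈C , c₀∈C ,
            trans g≡ (trans (cong (_⊖ a′) a≡a′) (trans (⊕-inverseʳ G a′) (sym (⊕-inverseʳ G c₀))))
        where
        w⊕a′≡w′⊕a : w ⊕ a′ ≡ w′ ⊕ a
        w⊕a′≡w′⊕a = sym (unswap (trans (sym g≡) g≡′))
        a≡a′ : a ≡ a′
        a≡a′ = sym (proj₂ (supp w w′ a′ a (∈-support⁺ (count xs) hw) (∈-support⁺ (count xs) hw′) a′∈ a∈ w⊕a′≡w′⊕a))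

-- Choice of parameters and conclusion

-- Take `f` to be the integer part of `n/B`, so `n < (f + 1)B`. If `2^(f+1) ≤ n^4`, then
-- `2^n < 2^((f+1)B) ≤ n^(4B)`, against the hypothesis. The fourth power absorbs constants: `n ≥ 2`
-- gives `8n ≤ n^4 < 2^(f+1)`.
quotient-bounds : ∀ n B → 2 ≤ n → 1 ≤ B → n ^ (4 * B) ≤ 2 ^ n →
  ∃ λ f → 1 ≤ f × 4 * n < 2 ^ f × B * f ≤ n × n ≤ 2 * (B * f)
quotient-bounds n B@(suc _) 2≤n _ n^4B≤2^n = f , 1≤f , 4n<2^f ,
  ≤-trans (≤-reflexive (*-comm B f)) (m/n*n≤m n B) , (begin
    n                  ≤⟨ <⇒≤ n<[1+f]B ⟩
    suc f * B          ≤⟨ *-monoˡ-≤ B (+-monoˡ-≤ f 1≤f) ⟩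
    (f + f) * B        ≡⟨ solve 2 (λ f B → (f :+ f) :* B := con 2 :* (B :* f)) refl f B ⟩
    2 * (B * f)        ∎)
  where
  open ≤-Reasoning
  f = n / B
  n<[1+f]B : n < suc f * B
  n<[1+f]B = ≤-<-trans (≤-reflexive (m≡m%n+[m/n]*n n B)) (+-monoˡ-< (f * B) (m%n<n n B))
  n^4<2^[1+f] : n ^ 4 < 2 ^ suc f
  n^4<2^[1+f] = ≰⇒> λ le → <-irrefl refl (begin-strict
    2 ^ n              <⟨ ^-monoʳ-< 2 ≤-refl n<[1+f]B ⟩
    2 ^ (suc f * B)    ≡⟨ ^-*-assoc 2 (suc f) B ⟨
    (2 ^ suc f) ^ B    ≤⟨ ^-monoˡ-≤ B le ⟩
    (n ^ 4) ^ B        ≡⟨ ^-*-assoc n 4 B ⟩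
    n ^ (4 * B)        ≤⟨ n^4B≤2^n ⟩
    2 ^ n              ∎)
  4n<2^f : 4 * n < 2 ^ f
  4n<2^f = *-cancelˡ-< 2 (4 * n) (2 ^ f) (begin-strict
    2 * (4 * n)                    ≡⟨ solve 1 (λ n → con 2 :* (con 4 :* n) := n :* con 8) refl n ⟩
    n * 8                          ≤⟨ *-monoʳ-≤ n (*-mono-≤ 2≤n (*-mono-≤ 2≤n (*-monoˡ-≤ 1 2≤n))) ⟩
    n ^ 4                          <⟨ n^4<2^[1+f] ⟩
    2 ^ suc f                      ∎)
  positive : ∀ k → 4 * n < 2 ^ k → 1 ≤ k
  positive zero    lt = ⊥-elim (<⇒≱ lt (*-mono-≤ {1} {4} (s≤s z≤n) (<⇒≤ 2≤n)))
  positive (suc _) _  = s≤s z≤n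
  1≤f : 1 ≤ f
  1≤f = positive f 4n<2^f

-- Matches the hypothesis on `C` with the exponent `4 * B` of `quotient-bounds`: `k` is the size of
-- `C`, `s` the total of `diffs C`, and `α`, `β` stand for 16 and 32.
exponent : ∀ q α β k s → q ≡ 4 * (8 * (α * α * β)) → s ≡ k * k → q * k ^ 4 ≡ 4 * (8 * ((α * s) * (α * s) * β))
exponent q α β k s refl refl = solve 3 (λ α β k → con 4 :* (con 8 :* (α :* α :* β)) :* (k :* (k :* (k :* (k :* con 1)))) :=
  con 4 :* (con 8 :* ((α :* (k :* k)) :* (α :* (k :* k)) :* β))) refl α β k

maximal-supplement : ∀ {n} (G : FinAbGroup n) (C : Subset n) q → q ≡ 4 * (8 * (16 * 16 * 32)) →
  2 ≤ n → Nonempty C → IsSolid G C → n ^ (q * ∣ C ∣ ^ 4) ≤ 2 ^ (1 * n) → IsMaximalSupplement G C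
maximal-supplement {n} G C q q≡ 2≤n nonempty@(c , c∈C) solid small =
  let f , 1≤f , 4n<2^f , lower , upper = quotient-bounds n B 2≤n 1≤B (subst₂ _≤_ (cong (n ^_) (exponent q 16 32 ∣ C ∣ s q≡ (sum-diffs G C))) (cong (2 ^_) (*-identityˡ n)) small)
      xs , ind , cover = covering G D 1≤D0 f (<⇒≤ 2≤n) 1≤f 4n<2^f lower upper
  in covering⇒maximal G C nonempty solid xs ind cover
  where
  D : Fin n → ℕ
  D = diffs G C
  s t B : ℕ
  s = sum D
  t = 16 * s
  B = 8 * (t * t * 32)
  1≤D0 : 1 ≤ D (FinAbGroup.0g G)
  1≤D0 = InDiff⇒1≤diffs G C _ (c , c , c∈C , c∈C , sym (⊕-inverseʳ G c))
  1≤t : 1 ≤ t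
  1≤t = *-mono-≤ {1} {16} (s≤s z≤n) (≤-trans 1≤D0 (term≤sum D _))
  1≤B : 1 ≤ B
  1≤B = *-mono-≤ {1} {8} (s≤s z≤n) (*-mono-≤ {1} {t * t} {1} {32} (*-mono-≤ 1≤t 1≤t) (s≤s z≤n))

-- Taking logarithms, the numerical hypothesis reads `|C|^4 ≤ (p log 2 / q) n / log n`, so the pair
-- `p`, `q` encodes the constant `b = (p log 2 / q)^(1/4)`.
theorem1p5 : Σ ℕ λ p → Σ ℕ λ q → 1 ≤ p × 1 ≤ q ×
    (∀ (n : ℕ) (G : FinAbGroup n) (C : Subset n) → 2 ≤ n → Nonempty C →
    IsSolid G C → n ^ (q * (∣ C ∣ ^ 4)) ≤ 2 ^ (p * n) →
    IsMaximalSupplement G C)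
-- `262144 = 4 · 8 · 16² · 32`, the numerical factor of `4 * B`.
theorem1p5 = 1 , 262144 , s≤s z≤n , s≤s z≤n , λ n G C → maximal-supplement G C 262144 refl
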